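{- Let $k\ge 1$ and $n\ge 1$ be integers and let $U_n=K_3\times P_n$. If the $3n$ vertices of $U_n$ are colored uniformly and independently with $k$ colors, the expected number of blocks is $$\mathbb{E}[X_k(U_n)]=\frac{k^{3n-5}\left((1 - 3 k^2 + 3 k^4) -(1 - k)^3 (1 + 3 k + 3 k^2) n\right)}{k^{3n}}.$$
   Context: $K_m$ is the complete graph on $m$ vertices and $P_n$ the path graph on $n$ vertices. The product $G_1\times G_2$ of graphs $G_1=(V_1,E_1)$, $G_2=(V_2,E_2)$ is the Cartesian product: its vertex set is $V_1\times V_2$, and $(v_1,v_2),(w_1,w_2)$ are adjacent iff ($v_1=w_1$ and $\{v_2,w_2\}\in E_2$) or ($v_2=w_2$ and $\{v_1,w_1\}\in E_1$). Given a coloring of the vertices of a finite graph $G$ with $k$ colors, the blocks are the connected components of the subgraph of $G$ formed by all vertices and all edges whose two endpoints have the same color. $X_k(G)$ denotes the number of blocks when each vertex of $G$ receives independently a uniformly random color among $k$ colors. -}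

module Defs where

open import Data.Fin.Base using (Fin; toℕ; finToFun)
open import Data.Fin.Properties using (inj⇒≟; *↔×)
import Data.Fin.Properties as Fin
open import Data.Integer.Base using (ℤ; +_; -[1+_])
open import Data.List.Base using (List; []; _∷_; map; length; deduplicate; allFin; tabulate)
open import Data.List.Membership.Propositional using (_∈_)
open import Data.List.Membership.Propositional.Properties using (∈-map⁺; ∈-allFin)
open import Data.List.Relation.Unary.AllPairs using (AllPairs)
open import Data.List.Relation.Unary.Any as Any using (Any; here; there)
import Data.List.Relation.Unary.Any.Properties as Any
import Data.List.Relation.Unary.Unique.DecSetoid.Properties as Unique
open import Data.Nat.Base as ℕ using (ℕ; suc; NonZero)
open import Data.Nat.ListAction using (sum)
import Data.Nat.Properties as ℕ
open import Data.Product.Base using (_×_; _,_)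
open import Data.Product.Function.NonDependent.Propositional using (_×-↔_)
open import Data.Rational.Base as ℚ using (ℚ; _/_)
import Data.Rational.Properties as ℚ
open import Data.Sum.Base using (_⊎_; inj₁; inj₂; swap)
open import Function.Base using (_∘_)
open import Function.Bundles using (_↔_; Inverse)
open import Function.Construct.Composition using (_↔-∘_)
open import Function.Construct.Identity using (↔-id)
open import Function.Properties.Inverse using (↔-sym; ↔⇒↣)
open import Level using (0ℓ)
open import Relation.Binary.Bundles using (DecSetoid)
open import Relation.Binary.Construct.Closure.ReflexiveTransitive using (Star; ε; _◅_; _◅◅_; return; reverse)
open import Relation.Binary.Core using (Rel)
open import Relation.Binary.Definitions using (Decidable; DecidableEquality; Symmetric; Irreflexive)
open import Relation.Binary.PropositionalEquality using (_≡_; _≢_; refl; sym; subst; ≢-sym)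
open import Relation.Nullary.Decidable using (map′; _×-dec_; _⊎-dec_; ¬?)
open import Relation.Nullary.Negation using (¬_)

record Graph : Set₁ where
  infix 4 _~_ _~?_ _≟_
  field
    Vertex      : Set
    order       : ℕ
    enumeration : Fin order ↔ Vertex
    _~_         : Rel Vertex 0ℓ
    ~-sym       : Symmetric _~_
    ~-irrefl    : Irreflexive _≡_ _~_
    _~?_        : Decidable _~_

  vertices : List Vertex
  vertices = map (Inverse.to enumeration) (allFin order)

  ∈-vertices : ∀ v → v ∈ vertices
  ∈-vertices v = subst (_∈ vertices) (Inverse.strictlyInverseˡ enumeration v)
    (∈-map⁺ (Inverse.to enumeration) (∈-allFin (Inverse.from enumeration v)))

  _≟_ : DecidableEquality Vertex
  _≟_ = inj⇒≟ (↔⇒↣ (↔-sym enumeration))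

K : ℕ → Graph
K m = record
  { Vertex      = Fin m
  ; order       = m
  ; enumeration = ↔-id (Fin m)
  ; _~_         = _≢_
  ; ~-sym       = ≢-sym
  ; ~-irrefl    = λ i≡j i≢j → i≢j i≡j
  ; _~?_        = λ i j → ¬? (i Fin.≟ j)
  }

P : ℕ → Graph
P n = record
  { Vertex      = Fin n
  ; order       = n
  ; enumeration = ↔-id (Fin n)
  ; _~_         = λ i j → suc (toℕ i) ≡ toℕ j ⊎ suc (toℕ j) ≡ toℕ i
  ; ~-sym       = swap
  ; ~-irrefl    = λ { refl (inj₁ eq) → ℕ.1+n≢n eq ; refl (inj₂ eq) → ℕ.1+n≢n eq }
  ; _~?_        = λ i j → (suc (toℕ i) ℕ.≟ toℕ j) ⊎-dec (suc (toℕ j) ℕ.≟ toℕ i)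
  }

infixr 7 _□_

_□_ : Graph → Graph → Graph
G₁ □ G₂ = record
  { Vertex      = G₁.Vertex × G₂.Vertex
  ; order       = G₁.order ℕ.* G₂.order
  ; enumeration = (G₁.enumeration ×-↔ G₂.enumeration) ↔-∘ *↔×
  ; _~_         = λ { (v₁ , v₂) (w₁ , w₂) →
                      (v₁ ≡ w₁ × v₂ G₂.~ w₂) ⊎ (v₂ ≡ w₂ × v₁ G₁.~ w₁) }
  ; ~-sym       = λ { (inj₁ (eq , adj)) → inj₁ (sym eq , G₂.~-sym adj)
                    ; (inj₂ (eq , adj)) → inj₂ (sym eq , G₁.~-sym adj) }
  ; ~-irrefl    = λ { refl (inj₁ (_ , adj)) → G₂.~-irrefl refl adj
                    ; refl (inj₂ (_ , adj)) → G₁.~-irrefl refl adj }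
  ; _~?_        = λ { (v₁ , v₂) (w₁ , w₂) →
                      ((v₁ G₁.≟ w₁) ×-dec (v₂ G₂.~? w₂)) ⊎-dec
                      ((v₂ G₂.≟ w₂) ×-dec (v₁ G₁.~? w₁)) }
  }
  where
  module G₁ = Graph G₁
  module G₂ = Graph G₂

U : ℕ → Graph
U n = K 3 □ P n

module _ (G : Graph) where
  open Graph G

  Connected : Rel Vertex 0ℓ
  Connected = Star _~_

  -- Via xs v w: there is a walk from v to w whose inner vertices all lie in xs
  -- (the Floyd–Warshall recursion). It serves only to decide Connected.
  Via : List Vertex → Rel Vertex 0ℓ
  Via []       v w = v ≡ w ⊎ v ~ w
  Via (x ∷ xs) v w = Via xs v w ⊎ (Via xs v x × Via xs x w)

  via? : ∀ xs → Decidable (Via xs)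
  via? []       v w = (v ≟ w) ⊎-dec (v ~? w)
  via? (x ∷ xs) v w = via? xs v w ⊎-dec (via? xs v x ×-dec via? xs x w)

  via⇒connected : ∀ xs {v w} → Via xs v w → Connected v w
  via⇒connected []       (inj₁ refl)    = ε
  via⇒connected []       (inj₂ adj)     = return adj
  via⇒connected (x ∷ xs) (inj₁ p)       = via⇒connected xs p
  via⇒connected (x ∷ xs) (inj₂ (p , q)) = via⇒connected xs p ◅◅ via⇒connected xs q

  via-base : ∀ xs {v w} → v ≡ w ⊎ v ~ w → Via xs v w
  via-base []       p = p
  via-base (x ∷ xs) p = inj₁ (via-base xs p)

  via-trans : ∀ {xs x v w} → x ∈ xs → Via xs v x → Via xs x w → Via xs v w
  via-trans (here refl) (inj₁ p)       (inj₁ q)       = inj₂ (p , q)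
  via-trans (here refl) (inj₁ p)       (inj₂ (_ , q)) = inj₂ (p , q)
  via-trans (here refl) (inj₂ (p , _)) (inj₁ q)       = inj₂ (p , q)
  via-trans (here refl) (inj₂ (p , _)) (inj₂ (_ , q)) = inj₂ (p , q)
  via-trans (there x∈)  (inj₁ p)       (inj₁ q)       = inj₁ (via-trans x∈ p q)
  via-trans (there x∈)  (inj₁ p)       (inj₂ (q , r)) = inj₂ (via-trans x∈ p q , r)
  via-trans (there x∈)  (inj₂ (p , q)) (inj₁ r)       = inj₂ (p , via-trans x∈ q r)
  via-trans (there x∈)  (inj₂ (p , _)) (inj₂ (_ , q)) = inj₂ (p , q)

  connected⇒via : ∀ {v w} → Connected v w → Via vertices v w
  connected⇒via ε          = via-base vertices (inj₁ refl)
  connected⇒via (adj ◅ p) =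
    via-trans (∈-vertices _) (via-base vertices (inj₂ adj)) (connected⇒via p)

  connected? : Decidable Connected
  connected? v w = map′ (via⇒connected vertices) connected⇒via (via? vertices v w)

  connectedDecSetoid : DecSetoid 0ℓ 0ℓ
  connectedDecSetoid = record
    { Carrier          = Vertex
    ; _≈_              = Connected
    ; isDecEquivalence = record
      { isEquivalence = record { refl = ε ; sym = reverse ~-sym ; trans = _◅◅_ }
      ; _≟_           = connected?
      }
    }

  -- Exactly one vertex of each connected component, by the two lemmas below.
  representatives : List Vertex
  representatives = deduplicate connected? vertices

  representatives-distinct : AllPairs (λ v w → ¬ Connected v w) representatives
  representatives-distinct = Unique.deduplicate-! connectedDecSetoid vertices

  representatives-complete : ∀ v → Any (Connected v) representatives
  representatives-complete v = Any.deduplicate⁺ connected?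
    (λ y~x v~x → v~x ◅◅ reverse ~-sym y~x)
    (Any.map (λ { refl → ε }) (∈-vertices v))

  numComponents : ℕ
  numComponents = length representatives

Coloring : ℕ → Graph → Set
Coloring k G = Graph.Vertex G → Fin k

module _ {k : ℕ} (G : Graph) (c : Coloring k G) where
  open Graph G

  monochromatic : Graph
  monochromatic = record
    { Vertex      = Vertex
    ; order       = order
    ; enumeration = enumeration
    ; _~_         = λ v w → v ~ w × c v ≡ c w
    ; ~-sym       = λ { (adj , eq) → ~-sym adj , sym eq }
    ; ~-irrefl    = λ { v≡w (adj , _) → ~-irrefl v≡w adj }
    ; _~?_        = λ v w → (v ~? w) ×-dec (c v Fin.≟ c w)
    }

  numBlocks : ℕ
  numBlocks = numComponents monochromatic

-- finToFun is the bijection between Fin (k ^ N) and the functions Fin N → Fin k,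
-- so that every coloring occurs for exactly one index.
coloring : ∀ (k : ℕ) (G : Graph) → Fin (k ℕ.^ Graph.order G) → Coloring k G
coloring k G i = finToFun i ∘ Inverse.from (Graph.enumeration G)

uniformMean : ∀ {m} .{{_ : NonZero m}} → (Fin m → ℕ) → ℚ
uniformMean {m} X = + sum (tabulate X) / m

-- Independent uniform colors on the vertices amount to the uniform distribution
-- on the set of all colorings.
𝔼[X] : ∀ (k : ℕ) .{{_ : NonZero k}} → Graph → ℚ
𝔼[X] k G = uniformMean {{ℕ.m^n≢0 k (Graph.order G)}} (λ i → numBlocks G (coloring k G i))

infixr 8 _^ᶻ_

_^ᶻ_ : (k : ℕ) .{{_ : NonZero k}} → ℤ → ℚ
k ^ᶻ (+ m)    = + (k ℕ.^ m) / 1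
k ^ᶻ -[1+ m ] = _/_ (+ 1) (k ℕ.^ suc m) {{ℕ.m^n≢0 k (suc m)}}

^ᶻ-nonZero : ∀ k .{{_ : NonZero k}} z → ℚ.NonZero (k ^ᶻ z)
^ᶻ-nonZero k (+ m)    = ℚ.pos⇒nonZero (k ^ᶻ (+ m))
  {{ℚ.normalize-pos (k ℕ.^ m) 1 {{_}} {{ℕ.m^n≢0 k m}}}}
^ᶻ-nonZero k -[1+ m ] = ℚ.pos⇒nonZero (k ^ᶻ -[1+ m ])
  {{ℚ.normalize-pos 1 (k ℕ.^ suc m) {{ℕ.m^n≢0 k (suc m)}}}}

{-# OPTIONS --safe #-}
module Submission where

-- Two vertices of one column are adjacent, so they lie in the same block exactly when they have the
-- same color: how the blocks meet a column depends on the colors of that column only. Build the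
-- graph by putting columns in front. A color class of the new first column is a new block unless one
-- of its vertices has the color of its neighbour in the next column; then it joins precisely one old
-- block. So the number of blocks is a sum of local terms, each depending on two consecutive columns.
-- By inclusion-exclusion such a term is a polynomial in indicators of color equalities, and summing
-- it over all colorings yields an affine recurrence in n.

open import Defs
open import Data.Bool.Base using (Bool; true; false; T; _∧_)
open import Data.Bool.Properties using (T-∧; T-≡)
open import Data.Fin.Base using (Fin; zero; suc; toℕ; _↑ˡ_; _↑ʳ_; combine; finToFun; funToFin)
open import Data.Fin.Patterns using (0F; 1F; 2F)
import Data.Fin.Properties as Fin
open import Data.Integer.Base using (ℤ; +_; -_; _⊖_; _+_; _-_; _*_; _^_)
import Data.Integer.Properties as ℤ
open import Data.Integer.Tactic.RingSolver using (solve-∀)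
open import Data.List.Base as List using (List; _++_; map; length; filterᵇ; allFin; tabulate)
open import Data.List.Membership.Propositional using (_∈_; find)
open import Data.List.Membership.Propositional.Properties using (∈-map⁺; ∈-map⁻; ∈-++⁺ˡ; ∈-++⁺ʳ; ∈-++⁻; ∈-filter⁺; ∈-filter⁻; ∈-allFin)
open import Data.List.Membership.Propositional.Properties.WithK using (unique∧set⇒bag)
open import Data.List.Properties using (length-map; length-++; filter-≐)
open import Data.List.Relation.Binary.BagAndSetEquality using (∼bag⇒↭)
open import Data.List.Relation.Binary.Permutation.Propositional.Properties using (↭-length)
import Data.List.Relation.Unary.AllPairs as AllPairs
import Data.List.Relation.Unary.AllPairs.Properties as AllPairs
open import Data.List.Relation.Unary.Unique.Propositional using (Unique)
import Data.List.Relation.Unary.Unique.Propositional.Properties as Unique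
open import Data.Maybe.Base using (Maybe; just; nothing; maybe; fromMaybe; is-nothing)
open import Data.Nat.Base as ℕ using (ℕ; zero; suc; NonZero)
import Data.Nat.ListAction as ListAction
import Data.Nat.Properties as ℕ
open import Data.Product.Algebra using (×-comm)
open import Data.Product.Base using (∃-syntax; _×_; _,_; proj₁; proj₂; swap; uncurry)
open import Data.Rational.Base as ℚ using (ℚ; _/_; _÷_)
import Data.Rational.Properties as ℚ
open import Data.Rational.Unnormalised.Base as ℚᵘ using (mkℚᵘ; *≡*)
import Data.Rational.Unnormalised.Properties as ℚᵘ
open import Data.Sum.Base using (_⊎_; inj₁; inj₂)
open import Data.Vec.Functional using (_∷_; [])
open import Function.Base using (_∘_)
open import Function.Bundles using (_↔_; mk↔ₛ′; mk⇔; Equivalence; Inverse)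
open import Function.Construct.Composition using (_↔-∘_)
open import Function.Properties.Inverse using (↔-sym)
open import Relation.Binary.Construct.Closure.ReflexiveTransitive using (ε; _◅_; _◅◅_; return; gmap; reverse)
open import Relation.Binary.PropositionalEquality using (_≡_; _≗_; refl; sym; trans; cong; cong₂; subst; module ≡-Reasoning)
open import Relation.Nullary.Decidable using (Dec; yes; no; does; T?; dec-true; does-⇔; map′; _×-dec_; _→-dec_; toWitness)
open import Relation.Nullary.Negation using (contradiction)

open import Algebra.Properties.Semiring.Sum ℤ.+-*-semiring using (sum; sum-syntax; sum-cong-≗; ∑-distrib-+; *-distribˡ-sum; sum-permute)

-- Counting components through canonical roots.

module _ (G : Graph) where
  open Graph G

  module _ (root : Vertex → Vertex)
           (root-~ : ∀ {v w} → v ~ w → root v ≡ root w)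
           (connected-root : ∀ v → Connected G v (root v)) where

    root-connected : ∀ {v w} → Connected G v w → root v ≡ root w
    root-connected ε        = refl
    root-connected (e ◅ es) = trans (root-~ e) (root-connected es)

    root-idem : ∀ v → root (root v) ≡ root v
    root-idem v = sym (root-connected (connected-root v))

    root-≡⇒connected : ∀ {v w} → root v ≡ root w → Connected G v w
    root-≡⇒connected {v} {w} eq =
      subst (Connected G v) eq (connected-root v) ◅◅ reverse ~-sym (connected-root w)

    -- Taking roots is injective on `representatives`, because equal roots force connectedness, and
    -- every fixed point is reached, being the root of the representative of its component. So two
    -- duplicate-free lists with the same elements are compared.
    numComponents-roots : ∀ {rs} → Unique rs → (∀ {v} → v ∈ rs → root v ≡ v) →
                          (∀ {v} → root v ≡ v → v ∈ rs) → numComponents G ≡ length rs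
    numComponents-roots {rs} rs! fixed complete = begin
      length (representatives G)            ≡⟨ length-map root (representatives G) ⟨
      length (map root (representatives G)) ≡⟨ ↭-length (∼bag⇒↭ (unique∧set⇒bag reps! rs! (mk⇔ to from))) ⟩
      length rs                             ∎
      where
      open ≡-Reasoning
      reps! : Unique (map root (representatives G))
      reps! = AllPairs.map⁺ (AllPairs.map (λ ¬c eq → ¬c (root-≡⇒connected eq)) (representatives-distinct G))
      to : ∀ {v} → v ∈ map root (representatives G) → v ∈ rs
      to v∈ with u , _ , refl ← ∈-map⁻ root v∈ = complete (root-idem u)
      from : ∀ {v} → v ∈ rs → v ∈ map root (representatives G)
      from {v} v∈ with w , w∈ , c ← find (representatives-complete G v) =
        subst (_∈ _) (trans (sym (root-connected c)) (fixed v∈)) (∈-map⁺ root w∈)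

-- The blocks opened by a single column.

first : (Fin 3 → Bool) → Maybe (Fin 3)
first p with p 0F | p 1F | p 2F
... | true  | _     | _     = just 0F
... | false | true  | _     = just 1F
... | false | false | true  = just 2F
... | false | false | false = nothing

first-spec : ∀ p → (∃[ i ] first p ≡ just i × p i ≡ true) ⊎ (first p ≡ nothing × ∀ i → p i ≡ false)
first-spec p with p 0F in eq₀ | p 1F in eq₁ | p 2F in eq₂
... | true  | _     | _     = inj₁ (0F , refl , eq₀)
... | false | true  | _     = inj₁ (1F , refl , eq₁)
... | false | false | true  = inj₁ (2F , refl , eq₂)
... | false | false | false = inj₂ (refl , λ { 0F → eq₀ ; 1F → eq₁ ; 2F → eq₂ })

first-cong : ∀ {p q} → p ≗ q → first p ≡ first q
first-cong p≗q rewrite p≗q 0F | p≗q 1F | p≗q 2F = refl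

first-just : ∀ p {i} → p i ≡ true → ∃[ j ] first p ≡ just j × p j ≡ true
first-just p {i} pi with first-spec p
... | inj₁ res = res
... | inj₂ (_ , none) = contradiction (trans (sym pi) (none i)) λ ()

-- E i j stands for "rows i and j of the column have the same color", m i for "row i has the same
-- color in the next column". The default 0F of leader is never reached, as E is reflexive.
leader : (Fin 3 → Fin 3 → Bool) → Fin 3 → Fin 3
leader E i = fromMaybe 0F (first (λ j → E j i))

module _ (E : Fin 3 → Fin 3 → Bool) (m : Fin 3 → Bool) where

  -- The search runs over the whole color class and does not prefer row `i` even if it is linked, so
  -- that all rows of a class share one exit.
  exit : Fin 3 → Maybe (Fin 3)
  exit i = first (λ j → E j i ∧ m j)

  -- The comparison with the leader makes a class without links count exactly once.
  opens : Fin 3 → Bool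
  opens i = is-nothing (exit i) ∧ does (leader E i Fin.≟ i)

  newBlocks : ℕ
  newBlocks = length (filterᵇ opens (allFin 3))

module _ {E E′ : Fin 3 → Fin 3 → Bool} {m m′ : Fin 3 → Bool}
         (E≗E′ : ∀ i j → E i j ≡ E′ i j) (m≗m′ : m ≗ m′) where

  opens-cong : opens E m ≗ opens E′ m′
  opens-cong i = cong₂ _∧_
    (cong is-nothing (first-cong (λ j → cong₂ _∧_ (E≗E′ j i) (m≗m′ j))))
    (cong (λ l → does (fromMaybe 0F l Fin.≟ i)) (first-cong (λ j → E≗E′ j i)))

  newBlocks-cong : newBlocks E m ≡ newBlocks E′ m′
  newBlocks-cong = cong length (filter-≐ (T? ∘ opens E m) (T? ∘ opens E′ m′)
    ((λ {i} → subst T (opens-cong i)) , (λ {i} → subst T (sym (opens-cong i)))) (allFin 3))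

-- Roots of the blocks of a colored prism.

shift : ∀ {n} → Fin 3 × Fin n → Fin 3 × Fin (suc n)
shift (i , j) = i , suc j

shift-injective : ∀ {n} {v w : Fin 3 × Fin n} → shift v ≡ shift w → v ≡ w
shift-injective refl = refl

module _ {k : ℕ} where

  same : Fin k → Fin k → Bool
  same x y = does (x Fin.≟ y)

  same-true : ∀ x y → x ≡ y → same x y ≡ true
  same-true x y = dec-true (x Fin.≟ y)

  same-≡ : ∀ x y → T (same x y) → x ≡ y
  same-≡ x y t with yes x≡y ← x Fin.≟ y = x≡y

  equal : ∀ {n} → Coloring k (U (suc n)) → Fin 3 → Fin 3 → Bool
  equal c i j = same (c (i , zero)) (c (j , zero))

  link : ∀ {n} → Coloring k (U (suc n)) → Fin 3 → Bool
  -- No column follows the last one, so each of its color classes opens a block.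
  link {zero}  c i = false
  link {suc n} c i = same (c (i , zero)) (c (i , suc zero))

  -- Follow the block to the right as long as the color class has a link to the next column. The
  -- choice made at a column depends on the color only, which makes root constant on blocks.
  root : ∀ {n} → Coloring k (U n) → Fin 3 × Fin n → Fin 3 × Fin n
  root {suc n}       c (i , suc j) = shift (root (c ∘ shift) (i , j))
  root {suc zero}    c (i , zero)  = leader (equal c) i , zero
  root {suc (suc n)} c (i , zero)  =
    maybe (λ j → shift (root (c ∘ shift) (j , zero))) (leader (equal c) i , zero)
      (exit (equal c) (link c) i)

  equal-congʳ : ∀ {n} (c : Coloring k (U (suc n))) {i j} → c (i , zero) ≡ c (j , zero) →
                ∀ l → equal c l i ≡ equal c l j
  equal-congʳ c eq l = cong (same (c (l , zero))) eq

  leader-cong : ∀ {n} (c : Coloring k (U (suc n))) {i j} → c (i , zero) ≡ c (j , zero) →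
                leader (equal c) i ≡ leader (equal c) j
  leader-cong c eq = cong (fromMaybe 0F) (first-cong (equal-congʳ c eq))

  exit-cong : ∀ {n} (c : Coloring k (U (suc n))) {i j} → c (i , zero) ≡ c (j , zero) →
              exit (equal c) (link c) i ≡ exit (equal c) (link c) j
  exit-cong c eq = first-cong (λ l → cong (_∧ link c l) (equal-congʳ c eq l))

  leader-color : ∀ {n} (c : Coloring k (U (suc n))) i → c (leader (equal c) i , zero) ≡ c (i , zero)
  leader-color c i
    with j , eq , p ← first-just (λ l → equal c l i) {i} (same-true (c (i , zero)) _ refl)
    rewrite eq = same-≡ (c (j , zero)) _ (Equivalence.from T-≡ p)

  exit-colors : ∀ {n} (c : Coloring k (U (suc (suc n)))) i j → equal c j i ∧ link c j ≡ true →
                c (j , zero) ≡ c (i , zero) × c (j , zero) ≡ c (j , suc zero)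
  exit-colors c i j p with t , t′ ← Equivalence.to (T-∧ {equal c j i}) (Equivalence.from T-≡ p) =
    same-≡ (c (j , zero)) _ t , same-≡ (c (j , zero)) _ t′

  root-column : ∀ {n} (c : Coloring k (U n)) {i i′} j → c (i , j) ≡ c (i′ , j) →
                root c (i , j) ≡ root c (i′ , j)
  root-column {suc n}       c (suc j) eq = cong shift (root-column (c ∘ shift) j eq)
  root-column {suc zero}    c zero    eq = cong (_, zero) (leader-cong c eq)
  root-column {suc (suc n)} c zero    eq =
    cong₂ (λ l → maybe _ (l , zero)) (leader-cong c eq) (exit-cong c eq)

  -- Row `i` is linked, so its class has an exit, possibly at another row `j`. Both rows then have
  -- the same color in the next column as well, and `root-column` applies there.
  root-row : ∀ {n} (c : Coloring k (U n)) i j j′ → suc (toℕ j) ≡ toℕ j′ → c (i , j) ≡ c (i , j′) →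
             root c (i , j) ≡ root c (i , j′)
  root-row {suc n} c i (suc j) (suc j′) adj eq =
    cong shift (root-row (c ∘ shift) i j j′ (ℕ.suc-injective adj) eq)
  root-row {suc (suc n)} c i zero (suc zero) refl eq
    with j , exit≡ , p ← first-just (λ l → equal c l i ∧ link c l) {i}
           (cong₂ _∧_ (same-true (c (i , zero)) _ refl) (same-true (c (i , zero)) _ eq))
    with j≡i , j≡j′ ← exit-colors c i j p
    rewrite exit≡ = cong shift (root-column (c ∘ shift) zero (trans (sym j≡j′) (trans j≡i eq)))

  root-~ : ∀ {n} (c : Coloring k (U n)) {v w} → Graph._~_ (monochromatic (U n) c) v w →
           root c v ≡ root c w
  root-~ c {i , j} {_ , j′} (inj₁ (refl , inj₁ adj) , eq) = root-row c i j j′ adj eq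
  root-~ c {i , j} {_ , j′} (inj₁ (refl , inj₂ adj) , eq) = sym (root-row c i j′ j adj (sym eq))
  root-~ c {_ , j}          (inj₂ (refl , _)        , eq) = root-column c j eq

  connected-shift : ∀ {n} (c : Coloring k (U (suc n))) {v w} →
                    Connected (monochromatic (U n) (c ∘ shift)) v w →
                    Connected (monochromatic (U (suc n)) c) (shift v) (shift w)
  connected-shift c = gmap shift λ
    { (inj₁ (refl , inj₁ adj) , eq) → inj₁ (refl , inj₁ (cong suc adj)) , eq
    ; (inj₁ (refl , inj₂ adj) , eq) → inj₁ (refl , inj₂ (cong suc adj)) , eq
    ; (inj₂ (refl , i≢j)      , eq) → inj₂ (refl , i≢j) , eq }

  connected-column : ∀ {n} (c : Coloring k (U n)) {i i′ j} → c (i , j) ≡ c (i′ , j) →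
                     Connected (monochromatic (U n) c) (i , j) (i′ , j)
  connected-column c {i} {i′} eq with i Fin.≟ i′
  ... | yes refl = ε
  ... | no i≢i′  = return (inj₂ (refl , i≢i′) , eq)

  -- The path runs inside the column to the exit row, crosses its link and continues by the
  -- hypothesis; without an exit it ends at the leader.
  connected-exit : ∀ {n} (c : Coloring k (U (suc (suc n)))) →
    (∀ j → Connected (monochromatic (U (suc n)) (c ∘ shift)) (j , zero) (root (c ∘ shift) (j , zero))) →
    ∀ i → Connected (monochromatic (U (suc (suc n))) c) (i , zero) (root c (i , zero))
  connected-exit c ih i with first-spec (λ l → equal c l i ∧ link c l)
  ... | inj₂ (exit≡ , _) rewrite exit≡ = connected-column c (sym (leader-color c i))
  ... | inj₁ (j , exit≡ , p) with j≡i , j≡j′ ← exit-colors c i j p rewrite exit≡ =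
    connected-column c (sym j≡i) ◅◅ (inj₁ (refl , inj₁ refl) , j≡j′) ◅ connected-shift c (ih j)

  connected-root : ∀ {n} (c : Coloring k (U n)) v → Connected (monochromatic (U n) c) v (root c v)
  connected-root {suc n}       c (i , suc j) = connected-shift c (connected-root (c ∘ shift) (i , j))
  connected-root {suc zero}    c (i , zero)  = connected-column c (sym (leader-color c i))
  connected-root {suc (suc n)} c (i , zero)  =
    connected-exit c (λ j → connected-root (c ∘ shift) (j , zero)) i

  opens⇒fixed : ∀ {n} (c : Coloring k (U (suc n))) i → T (opens (equal c) (link c) i) →
                root c (i , zero) ≡ (i , zero)
  opens⇒fixed {n} c i p with exit (equal c) (link c) i in exit≡ | leader (equal c) i Fin.≟ i
  opens⇒fixed {zero}  c i p | nothing | yes l≡i = cong (_, zero) l≡i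
  opens⇒fixed {suc n} c i p | nothing | yes l≡i rewrite exit≡ = cong (_, zero) l≡i

  exit-last : ∀ (c : Coloring k (U 1)) i → exit (equal c) (link c) i ≡ nothing
  exit-last c i with first-spec (λ l → equal c l i ∧ link c l)
  ... | inj₂ (exit≡ , _) = exit≡
  ... | inj₁ (j , _ , p) = contradiction (Equivalence.from T-≡ p) (proj₂ ∘ Equivalence.to (T-∧ {equal c j i}))

  fixed⇒opens : ∀ {n} (c : Coloring k (U (suc n))) i → root c (i , zero) ≡ (i , zero) →
                T (opens (equal c) (link c) i)
  fixed⇒opens {zero}  c i eq rewrite exit-last c i =
    Equivalence.from T-≡ (dec-true (leader (equal c) i Fin.≟ i) (cong proj₁ eq))
  fixed⇒opens {suc n} c i eq with exit (equal c) (link c) i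
  ... | nothing = Equivalence.from T-≡ (dec-true (leader (equal c) i Fin.≟ i) (cong proj₁ eq))
  -- With an exit the root lies in a later column, so the vertex cannot be fixed.
  ... | just j with () ← cong proj₂ eq

  roots : ∀ {n} → Coloring k (U n) → List (Fin 3 × Fin n)
  roots {zero}  c = List.[]
  roots {suc n} c =
    map (_, zero) (filterᵇ (opens (equal c) (link c)) (allFin 3)) ++ map shift (roots (c ∘ shift))

  roots-unique : ∀ {n} (c : Coloring k (U n)) → Unique (roots c)
  roots-unique {zero}  c = AllPairs.[]
  roots-unique {suc n} c = Unique.++⁺
    (Unique.map⁺ (cong proj₁) (Unique.filter⁺ (T? ∘ opens (equal c) (link c)) (Unique.allFin⁺ 3)))
    (Unique.map⁺ shift-injective (roots-unique (c ∘ shift)))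
    λ (v∈ , v∈′) → disjoint (∈-map⁻ (_, zero) v∈) (∈-map⁻ shift v∈′)
    where
    disjoint : ∀ {v xs ys} → ∃[ i ] (i ∈ xs × v ≡ (i , zero)) → ∃[ w ] (w ∈ ys × v ≡ shift w) → _
    disjoint (_ , _ , refl) (_ , _ , ())

  roots-fixed : ∀ {n} (c : Coloring k (U n)) {v} → v ∈ roots c → root c v ≡ v
  roots-fixed {suc n} c v∈
    with ∈-++⁻ (map (_, zero) (filterᵇ (opens (equal c) (link c)) (allFin 3))) v∈
  ... | inj₁ v∈ˡ with i , i∈ , refl ← ∈-map⁻ (_, zero) v∈ˡ =
    opens⇒fixed c i (proj₂ (∈-filter⁻ (T? ∘ opens (equal c) (link c)) {xs = allFin 3} i∈))
  ... | inj₂ v∈ʳ with w , w∈ , refl ← ∈-map⁻ shift v∈ʳ = cong shift (roots-fixed (c ∘ shift) w∈)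

  fixed⇒roots : ∀ {n} (c : Coloring k (U n)) {v} → root c v ≡ v → v ∈ roots c
  fixed⇒roots {suc n} c {i , zero}  eq = ∈-++⁺ˡ (∈-map⁺ (_, zero)
    (∈-filter⁺ (T? ∘ opens (equal c) (link c)) (∈-allFin i) (fixed⇒opens c i eq)))
  fixed⇒roots {suc n} c {i , suc j} eq =
    ∈-++⁺ʳ _ (∈-map⁺ shift (fixed⇒roots (c ∘ shift) (shift-injective eq)))

  blocks : ∀ {n} → Coloring k (U n) → ℕ
  blocks {zero}  c = 0
  blocks {suc n} c = newBlocks (equal c) (link c) ℕ.+ blocks (c ∘ shift)

  length-roots : ∀ {n} (c : Coloring k (U n)) → length (roots c) ≡ blocks c
  length-roots {zero}  c = refl
  length-roots {suc n} c = trans (length-++ (map (_, zero) new))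
    (cong₂ ℕ._+_ (length-map (_, zero) new) (trans (length-map shift (roots (c ∘ shift))) (length-roots (c ∘ shift))))
    where new = filterᵇ (opens (equal c) (link c)) (allFin 3)

  -- Blocks correspond to the fixed points of `root`, and `blocks` counts these column by column.
  numBlocks≡blocks : ∀ {n} (c : Coloring k (U n)) → numBlocks (U n) c ≡ blocks c
  numBlocks≡blocks {n} c = trans
    (numComponents-roots (monochromatic (U n) c) (root c) (root-~ c) (connected-root c)
      (roots-unique c) (roots-fixed c) (fixed⇒roots c))
    (length-roots c)

  link-cong : ∀ {n} {c d : Coloring k (U (suc n))} → c ≗ d → link c ≗ link d
  link-cong {zero}  c≗d i = refl
  link-cong {suc n} c≗d i = cong₂ same (c≗d (i , zero)) (c≗d (i , suc zero))

  blocks-cong : ∀ {n} {c d : Coloring k (U n)} → c ≗ d → blocks c ≡ blocks d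
  blocks-cong {zero}  c≗d = refl
  blocks-cong {suc n} c≗d = cong₂ ℕ._+_
    (newBlocks-cong (λ i j → cong₂ same (c≗d (i , zero)) (c≗d (j , zero))) (link-cong c≗d))
    (blocks-cong (c≗d ∘ shift))

-- The local term as a polynomial in indicators.

∀Bool? : {P : Bool → Set} → (∀ b → Dec (P b)) → Dec (∀ b → P b)
∀Bool? P? = map′ (λ { (p , q) true → p ; (p , q) false → q }) (λ p → p true , p false)
  (P? true ×-dec P? false)

⟦_⟧ : Bool → ℤ
⟦ true ⟧  = + 1
⟦ false ⟧ = + 0

-- Three booleans encode the equality pattern of a column, which reduces the formula for `newBlocks`
-- to a finite check.
table : Bool → Bool → Bool → Fin 3 → Fin 3 → Bool
table e f g 0F 1F = e
table e f g 1F 0F = e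
table e f g 0F 2F = f
table e f g 2F 0F = f
table e f g 1F 2F = g
table e f g 2F 1F = g
table e f g 0F 0F = true
table e f g 1F 1F = true
table e f g 2F 2F = true

-- The numbers of color classes of a column, and of those with a link, by inclusion-exclusion;
-- e, f, g are the indicators of equal colors in rows 01, 02, 12, and p, q, r those of the links.
classes : ℤ → ℤ → ℤ → ℤ
classes e f g = + 3 - e - f - g + e * g

linkedClasses : ℤ → ℤ → ℤ → ℤ → ℤ → ℤ → ℤ
linkedClasses e f g p q r = p + q + r - e * p * q - f * p * r - g * q * r + e * g * p * q * r

-- The hypotheses say that table e f g is transitive.
newBlocks-table : ∀ e f g → (T e → T f → T g) → (T e → T g → T f) → (T f → T g → T e) → ∀ p q r →
  + newBlocks (table e f g) (p ∷ q ∷ r ∷ []) ≡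
  classes ⟦ e ⟧ ⟦ f ⟧ ⟦ g ⟧ - linkedClasses ⟦ e ⟧ ⟦ f ⟧ ⟦ g ⟧ ⟦ p ⟧ ⟦ q ⟧ ⟦ r ⟧
newBlocks-table = toWitness {a? =
  ∀Bool? λ e → ∀Bool? λ f → ∀Bool? λ g →
  (T? e →-dec (T? f →-dec T? g)) →-dec ((T? e →-dec (T? g →-dec T? f)) →-dec
  ((T? f →-dec (T? g →-dec T? e)) →-dec
  (∀Bool? λ p → ∀Bool? λ q → ∀Bool? λ r → _ ℤ.≟ _)))} _

module _ {k : ℕ} where

  δ : Fin k → Fin k → ℤ
  δ x y = ⟦ same x y ⟧

  same-sym : ∀ (x y : Fin k) → same x y ≡ same y x
  same-sym x y = does-⇔ (mk⇔ sym sym) (x Fin.≟ y) (y Fin.≟ x)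

  same-trans : ∀ (x y z : Fin k) → T (same x y) → T (same y z) → T (same x z)
  same-trans x y z p q rewrite same-≡ x y p = q

  same-table : ∀ (a : Fin 3 → Fin k) i j → same (a i) (a j) ≡
    table (same (a 0F) (a 1F)) (same (a 0F) (a 2F)) (same (a 1F) (a 2F)) i j
  same-table a 0F 0F = same-true (a 0F) _ refl
  same-table a 0F 1F = refl
  same-table a 0F 2F = refl
  same-table a 1F 0F = same-sym (a 1F) (a 0F)
  same-table a 1F 1F = same-true (a 1F) _ refl
  same-table a 1F 2F = refl
  same-table a 2F 0F = same-sym (a 2F) (a 0F)
  same-table a 2F 1F = same-sym (a 2F) (a 1F)
  same-table a 2F 2F = same-true (a 2F) _ refl

  newBlocks-colors : ∀ (a : Fin 3 → Fin k) m → + newBlocks (λ i j → same (a i) (a j)) m ≡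
    classes (δ (a 0F) (a 1F)) (δ (a 0F) (a 2F)) (δ (a 1F) (a 2F)) -
    linkedClasses (δ (a 0F) (a 1F)) (δ (a 0F) (a 2F)) (δ (a 1F) (a 2F)) ⟦ m 0F ⟧ ⟦ m 1F ⟧ ⟦ m 2F ⟧
  newBlocks-colors a m = trans
    (cong +_ (newBlocks-cong {m = m} {m′ = m 0F ∷ m 1F ∷ m 2F ∷ []} (same-table a)
      λ { 0F → refl ; 1F → refl ; 2F → refl }))
    (newBlocks-table (same x y) (same x z) (same y z)
      -- Transitivity of color equality through `x`, `y` and `z` in turn.
      (λ p q → same-trans y x z (subst T (same-sym x y) p) q)
      (same-trans x y z)
      (λ p q → same-trans x z y p (subst T (same-sym y z) q))
      (m 0F) (m 1F) (m 2F))
    where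
    x = a 0F
    y = a 1F
    z = a 2F

-- Sums over finite sets and over functions.

∑-const : ∀ n x → ∑[ _ < n ] x ≡ + n * x
∑-const zero    x = refl
∑-const (suc n) x = trans (cong (_+_ x) (∑-const n x)) (sym (ℤ.suc-* (+ n) x))

∑-+ : ∀ m {n} (f : Fin (m ℕ.+ n) → ℤ) → sum f ≡ ∑[ i < m ] f (i ↑ˡ n) + ∑[ j < n ] f (m ↑ʳ j)
∑-+ zero    f = sym (ℤ.+-identityˡ _)
∑-+ (suc m) f = trans (cong (_+_ (f zero)) (∑-+ m (f ∘ suc))) (sym (ℤ.+-assoc (f zero) _ _))

∑-* : ∀ m {n} (f : Fin (m ℕ.* n) → ℤ) → sum f ≡ ∑[ i < m ] ∑[ j < n ] f (combine i j)
∑-* zero        f = refl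
∑-* (suc m) {n} f = trans (∑-+ n f) (cong (_+_ (∑[ j < n ] f (j ↑ˡ (m ℕ.* n)))) (∑-* m (f ∘ (n ↑ʳ_))))

∑-δ : ∀ {k} (x : Fin k) → ∑[ y < k ] δ x y ≡ + 1
∑-δ {suc k} zero    = cong (_+_ (+ 1)) (trans (∑-const k (+ 0)) (ℤ.*-zeroʳ (+ k)))
∑-δ {suc k} (suc x) = trans (ℤ.+-identityˡ _) (∑-δ x)

-- Decoding and reindexing yield functions that agree only pointwise, so summands must respect
-- pointwise equality.
Extensional : {A B : Set} → ((A → B) → ℤ) → Set
Extensional F = ∀ {f g} → f ≗ g → F f ≡ F g

-- The most significant base-`k` digit encodes the value at `zero`.
finToFun-combine : ∀ {k N} (x : Fin k) (y : Fin (k ℕ.^ N)) →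
                   finToFun {k} {suc N} (combine x y) ≗ x ∷ finToFun y
finToFun-combine {k} {N} x y zero    = cong proj₁ (Fin.remQuot-combine {k} x y)
finToFun-combine {k} {N} x y (suc i) =
  cong (λ qr → finToFun {k} {N} (proj₂ qr) i) (Fin.remQuot-combine {k} x y)

funToFin-cong : ∀ {m n} {f g : Fin m → Fin n} → f ≗ g → funToFin f ≡ funToFin g
funToFin-cong {zero}  f≗g = refl
funToFin-cong {suc m} f≗g = cong₂ combine (f≗g zero) (funToFin-cong (f≗g ∘ suc))

-- The expectation times `k ^ 5` is `intercept - slope * n`; `slope` itself is nonpositive for
-- positive `k`.
intercept slope : ℤ → ℤ
intercept κ = + 1 - + 3 * κ ^ 2 + + 3 * κ ^ 4
slope κ     = (+ 1 - κ) ^ 3 * (+ 1 + + 3 * κ + + 3 * κ ^ 2)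

-- Sums over the colors of one or two columns.

module _ {k : ℕ} where

  -- Each indicator equals one for a single `z`. The polynomials below are affine in the indicators
  -- of the innermost color, so they can be summed one color at a time.
  ∑-affine : ∀ a b c (x y : Fin k) → ∑[ z < k ] (a + b * δ x z + c * δ y z) ≡ + k * a + b + c
  ∑-affine a b c x y = begin
    ∑[ z < k ] (a + b * δ x z + c * δ y z)
      ≡⟨ ∑-distrib-+ (λ z → a + b * δ x z) (λ z → c * δ y z) ⟩
    ∑[ z < k ] (a + b * δ x z) + ∑[ z < k ] (c * δ y z)
      ≡⟨ cong₂ _+_ (trans (∑-distrib-+ (λ _ → a) (λ z → b * δ x z))
                          (cong₂ _+_ (∑-const k a) (∑-*δ b x))) (∑-*δ c y) ⟩
    + k * a + b + c ∎
    where
    open ≡-Reasoning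
    ∑-*δ : ∀ b (x : Fin k) → ∑[ z < k ] (b * δ x z) ≡ b
    ∑-*δ b x = trans (sym (*-distribˡ-sum b (δ x))) (trans (cong (b *_) (∑-δ x)) (ℤ.*-identityʳ b))

  ∑³ : (Fin k → Fin k → Fin k → ℤ) → ℤ
  ∑³ f = ∑[ x < k ] ∑[ y < k ] ∑[ z < k ] f x y z

  ∑³-cong : ∀ {f g} → (∀ x y z → f x y z ≡ g x y z) → ∑³ f ≡ ∑³ g
  ∑³-cong f≗g = sum-cong-≗ λ x → sum-cong-≗ λ y → sum-cong-≗ λ z → f≗g x y z

  ∑³-distrib-+ : ∀ f g → ∑³ (λ x y z → f x y z + g x y z) ≡ ∑³ f + ∑³ g
  ∑³-distrib-+ f g = trans
    (sum-cong-≗ λ x → trans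
      (sum-cong-≗ λ y → ∑-distrib-+ (f x y) (g x y))
      (∑-distrib-+ (λ y → ∑[ z < k ] f x y z) (λ y → ∑[ z < k ] g x y z)))
    (∑-distrib-+ (λ x → ∑[ y < k ] ∑[ z < k ] f x y z) (λ x → ∑[ y < k ] ∑[ z < k ] g x y z))

  ∑³-*ˡ : ∀ a f → ∑³ (λ x y z → a * f x y z) ≡ a * ∑³ f
  ∑³-*ˡ a f = sym (trans (*-distribˡ-sum a λ x → ∑[ y < k ] ∑[ z < k ] f x y z)
    (sum-cong-≗ λ x → trans (*-distribˡ-sum a λ y → ∑[ z < k ] f x y z)
      (sum-cong-≗ λ y → *-distribˡ-sum a (f x y))))

  ∑³-const : ∀ a → ∑³ (λ _ _ _ → a) ≡ + k * (+ k * (+ k * a))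
  ∑³-const a = trans
    (sum-cong-≗ {k} λ _ → trans (sum-cong-≗ {k} λ _ → ∑-const k a) (∑-const k (+ k * a)))
    (∑-const k (+ k * (+ k * a)))

  -- A prescribed equal pair leaves `k * k` triples. The product `δ x y * δ y z` indicates that all
  -- three colors agree, which leaves `k` triples.
  ∑³-δ : ∀ a b c → ∑³ (λ x y z → a + b * (δ x y + δ x z + δ y z) + c * (δ x y * δ y z)) ≡
    + k * + k * + k * a + + 3 * (+ k * + k) * b + + k * c
  ∑³-δ a b c = trans (sum-cong-≗ sum-yz) (trans (∑-const k _) (regroup (+ k) a b c))
    where
    affine-z : ∀ a b c e f g → a + b * (e + f + g) + c * (e * g) ≡ (a + b * e) + b * f + (b + c * e) * g
    affine-z = solve-∀
    affine-y : ∀ κ a b c e → κ * (a + b * e) + b + (b + c * e) ≡ (κ * a + + 2 * b) + (κ * b + c) * e + + 0 * e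
    affine-y = solve-∀
    regroup : ∀ κ a b c → κ * (κ * (κ * a + + 2 * b) + (κ * b + c) + + 0) ≡
              κ * κ * κ * a + + 3 * (κ * κ) * b + κ * c
    regroup = solve-∀
    sum-yz : ∀ x → ∑[ y < k ] ∑[ z < k ] (a + b * (δ x y + δ x z + δ y z) + c * (δ x y * δ y z)) ≡
             + k * (+ k * a + + 2 * b) + (+ k * b + c) + + 0
    sum-yz x = trans
      (sum-cong-≗ λ y → trans
        (sum-cong-≗ λ z → affine-z a b c (δ x y) (δ x z) (δ y z))
        (trans (∑-affine (a + b * δ x y) b (b + c * δ x y) x y) (affine-y (+ k) a b c (δ x y))))
      -- Only one indicator is left; the second gets coefficient zero and an arbitrary color.
      (∑-affine (+ k * a + + 2 * b) (+ k * b + c) (+ 0) x x)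

  -- Equivalently, each of the `k` colors occurs in `k ^ 3 - (k - 1) ^ 3` colorings of a column.
  ∑³-classes : ∑³ (λ x y z → classes (δ x y) (δ x z) (δ y z)) ≡
    + 3 * (+ k * + k * + k) - + 3 * (+ k * + k) + + k
  ∑³-classes = trans
    (∑³-cong λ x y z → expand (δ x y) (δ x z) (δ y z))
    (trans (∑³-δ (+ 3) (- + 1) (+ 1)) (tidy (+ k)))
    where
    expand : ∀ e f g → + 3 - e - f - g + e * g ≡ + 3 + (- + 1) * (e + f + g) + + 1 * (e * g)
    expand = solve-∀
    tidy : ∀ κ → κ * κ * κ * + 3 + + 3 * (κ * κ) * (- + 1) + κ * + 1 ≡ + 3 * (κ * κ * κ) - + 3 * (κ * κ) + κ
    tidy = solve-∀

  -- The number of blocks opened by a column `x`, `y`, `z` in front of a column `u`, `v`, `w`.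
  fresh : (x y z u v w : Fin k) → ℤ
  fresh x y z u v w =
    classes (δ x y) (δ x z) (δ y z) -
    linkedClasses (δ x y) (δ x z) (δ y z) (δ x u) (δ y v) (δ z w)

  -- The first column is fixed, so its data `d`, `e`, `f`, `g` are constants. The three links are
  -- independent: a product of one, two or three of their indicators sums to `k * k`, `k` or one.
  ∑³-linked : ∀ d e f g (x y z : Fin k) →
    ∑³ (λ u v w → d - linkedClasses e f g (δ x u) (δ y v) (δ z w)) ≡
    + k * + k * + k * d - (+ 3 * (+ k * + k) - + k * (e + f + g) + e * g)
  ∑³-linked d e f g x y z = trans
    (sum-cong-≗ λ u → trans
      (sum-cong-≗ λ v → trans
        (sum-cong-≗ λ w → affine-w d e f g (δ x u) (δ y v) (δ z w))
        (trans (∑-affine _ _ (+ 0) z z) (affine-v (+ k) d e f g (δ x u) (δ y v))))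
      (trans (∑-affine _ _ (+ 0) y y) (affine-u (+ k) d e f g (δ x u))))
    (trans (∑-affine _ _ (+ 0) x x) (tidy (+ k) d e f g))
    where
    affine-w : ∀ d e f g p q r →
      d - (p + q + r - e * p * q - f * p * r - g * q * r + e * g * p * q * r) ≡
      (d - p - q + e * p * q) + (f * p + g * q - + 1 - e * g * p * q) * r + + 0 * r
    affine-w = solve-∀
    affine-v : ∀ κ d e f g p q →
      κ * (d - p - q + e * p * q) + (f * p + g * q - + 1 - e * g * p * q) + + 0 ≡
      (κ * (d - p) + f * p - + 1) + (κ * (e * p - + 1) + g - e * g * p) * q + + 0 * q
    affine-v = solve-∀
    affine-u : ∀ κ d e f g p →
      κ * (κ * (d - p) + f * p - + 1) + (κ * (e * p - + 1) + g - e * g * p) + + 0 ≡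
      (κ * κ * d - + 2 * κ + g) + (κ * (e + f) - κ * κ - e * g) * p + + 0 * p
    affine-u = solve-∀
    tidy : ∀ κ d e f g →
      κ * (κ * κ * d - + 2 * κ + g) + (κ * (e + f) - κ * κ - e * g) + + 0 ≡
      κ * κ * κ * d - (+ 3 * (κ * κ) - κ * (e + f + g) + e * g)
    tidy = solve-∀

  ∑³-fresh : ∑³ (λ x y z → ∑³ (fresh x y z)) ≡
    + k * + k * + k * (+ 3 * (+ k * + k * + k) - + 3 * (+ k * + k) + + k) -
    (+ 3 * (+ k * + k * + k * + k * + k) - + 3 * (+ k * + k * + k) + + k)
  ∑³-fresh = trans
    (∑³-cong λ x y z → trans
      (∑³-linked (classes (δ x y) (δ x z) (δ y z)) (δ x y) (δ x z) (δ y z) x y z)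
      (expand (+ k) (δ x y) (δ x z) (δ y z)))
    (trans (∑³-δ (+ 3 * (+ k * + k * + k) - + 3 * (+ k * + k)) (+ k - + k * + k * + k) (+ k * + k * + k - + 1))
      (tidy (+ k)))
    where
    expand : ∀ κ e f g →
      κ * κ * κ * (+ 3 - e - f - g + e * g) - (+ 3 * (κ * κ) - κ * (e + f + g) + e * g) ≡
      (+ 3 * (κ * κ * κ) - + 3 * (κ * κ)) + (κ - κ * κ * κ) * (e + f + g) + (κ * κ * κ - + 1) * (e * g)
    expand = solve-∀
    tidy : ∀ κ →
      κ * κ * κ * (+ 3 * (κ * κ * κ) - + 3 * (κ * κ)) + + 3 * (κ * κ) * (κ - κ * κ * κ) + κ * (κ * κ * κ - + 1) ≡
      κ * κ * κ * (+ 3 * (κ * κ * κ) - + 3 * (κ * κ) + κ) - (+ 3 * (κ * κ * κ * κ * κ) - + 3 * (κ * κ * κ) + κ)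
    tidy = solve-∀

  -- Sums over all colorings.

  ∑ᶠ : ∀ N → ((Fin N → Fin k) → ℤ) → ℤ
  ∑ᶠ N F = ∑[ i < k ℕ.^ N ] F (finToFun i)

  ∑ᶠ-suc : ∀ N {F} → Extensional F → ∑ᶠ (suc N) F ≡ ∑[ x < k ] ∑ᶠ N (λ g → F (x ∷ g))
  ∑ᶠ-suc N {F} ext = trans (∑-* k (F ∘ finToFun {k} {suc N}))
    (sum-cong-≗ λ x → sum-cong-≗ λ y → ext (finToFun-combine {k} {N} x y))

  -- Precomposition with a bijection of the positions permutes the codes of the functions.
  ∑ᶠ-reindex : ∀ {M N} (σ : Fin M ↔ Fin N) {F} → Extensional F →
               ∑ᶠ M F ≡ ∑ᶠ N (λ g → F (g ∘ Inverse.to σ))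
  ∑ᶠ-reindex {M} {N} σ {F} ext = trans (sum-permute (F ∘ finToFun) π)
    (sum-cong-≗ λ x → ext (Fin.finToFun-funToFin (finToFun {k} {N} x ∘ to)))
    where
    open Inverse σ
    precompose : ∀ {M N} → (Fin M → Fin N) → Fin (k ℕ.^ N) → Fin (k ℕ.^ M)
    precompose {M} {N} h x = funToFin (finToFun {k} {N} x ∘ h)
    precompose-inverse : ∀ {M N} (h : Fin M → Fin N) (h′ : Fin N → Fin M) → (∀ i → h (h′ i) ≡ i) →
              ∀ x → precompose h′ (precompose h x) ≡ x
    precompose-inverse {M} {N} h h′ hh′ x = trans
      (funToFin-cong λ i → trans (Fin.finToFun-funToFin (finToFun {k} {N} x ∘ h) (h′ i))
                                 (cong (finToFun {k} {N} x) (hh′ i)))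
      (Fin.funToFin-finToFin {N} {k} x)
    π : Fin (k ℕ.^ N) ↔ Fin (k ℕ.^ M)
    π = mk↔ₛ′ (precompose to) (precompose from)
      (precompose-inverse from to strictlyInverseʳ) (precompose-inverse to from strictlyInverseˡ)

  infixr 5 _▹_

  _▹_ : ∀ {n} → (Fin 3 → Fin k) → Coloring k (U n) → Coloring k (U (suc n))
  (a ▹ c) (i , zero)  = a i
  (a ▹ c) (i , suc j) = c (i , j)

  ▹-congʳ : ∀ {n} a {c d : Coloring k (U n)} → c ≗ d → a ▹ c ≗ a ▹ d
  ▹-congʳ a c≗d (i , zero)  = refl
  ▹-congʳ a c≗d (i , suc j) = c≗d (i , j)

  -- coloring enumerates the vertices row by row; here they are enumerated column by column.
  byColumns : ∀ {n} → (Fin (n ℕ.* 3) → Fin k) → Coloring k (U n)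
  byColumns f (i , j) = f (combine j i)

  total : ∀ n → (Coloring k (U n) → ℤ) → ℤ
  total n F = ∑ᶠ (n ℕ.* 3) (F ∘ byColumns)

  total-cong : ∀ n {F G} → F ≗ G → total n F ≡ total n G
  total-cong n F≗G = sum-cong-≗ {k ℕ.^ (n ℕ.* 3)} (F≗G ∘ byColumns ∘ finToFun)

  -- In the enumeration by columns the first three positions form the first column, so splitting off
  -- three values exposes it.
  total-suc : ∀ n {F} → Extensional F →
              total (suc n) F ≡ ∑³ (λ x y z → total n (λ c → F ((x ∷ y ∷ z ∷ []) ▹ c)))
  total-suc n {F} ext = trans
    (∑ᶠ-suc (2 ℕ.+ n ℕ.* 3) {F ∘ byColumns} (ext ∘ byColumns-cong))
    (sum-cong-≗ λ x → trans
      (∑ᶠ-suc (1 ℕ.+ n ℕ.* 3) {λ f → F (byColumns (x ∷ f))} (ext ∘ byColumns-cong ∘ ∷-cong))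
      (sum-cong-≗ λ y → trans
        (∑ᶠ-suc (n ℕ.* 3) {λ f → F (byColumns (x ∷ y ∷ f))} (ext ∘ byColumns-cong ∘ ∷-cong ∘ ∷-cong))
        (sum-cong-≗ λ z → sum-cong-≗ λ w → ext (byColumns-▹ x y z (finToFun w)))))
    where
    ∷-cong : ∀ {N x} {f g : Fin N → Fin k} → f ≗ g → (x ∷ f) ≗ (x ∷ g)
    ∷-cong f≗g zero    = refl
    ∷-cong f≗g (suc i) = f≗g i
    byColumns-cong : ∀ {n f g} → f ≗ g → byColumns {n} f ≗ byColumns g
    byColumns-cong f≗g (i , j) = f≗g (combine j i)
    byColumns-▹ : ∀ {n} x y z (f : Fin (n ℕ.* 3) → Fin k) →
                  byColumns {suc n} (x ∷ y ∷ z ∷ f) ≗ (x ∷ y ∷ z ∷ []) ▹ byColumns f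
    byColumns-▹ x y z f (0F , zero)  = refl
    byColumns-▹ x y z f (1F , zero)  = refl
    byColumns-▹ x y z f (2F , zero)  = refl
    byColumns-▹ x y z f (i  , suc j) = refl

  blocks-ext : ∀ {n} → Extensional (λ (c : Coloring k (U n)) → + blocks c)
  blocks-ext c≗d = cong +_ (blocks-cong c≗d)

  -- The enumerations by rows and by columns differ by a transposition of the positions, which only
  -- permutes the summands.
  total-numBlocks : ∀ n → ∑[ i < k ℕ.^ (3 ℕ.* n) ] (+ numBlocks (U n) (coloring k (U n) i)) ≡
                    total n (λ c → + blocks c)
  total-numBlocks n = trans
    (sum-cong-≗ λ i → cong +_ (numBlocks≡blocks (coloring k (U n) i)))
    (trans
      (∑ᶠ-reindex transpose {λ f → + blocks {k} {n} λ (i , j) → f (combine i j)}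
        (λ f≗g → blocks-ext {n} λ (i , j) → f≗g (combine i j)))
      (sum-cong-≗ λ x → blocks-ext {n} λ (i , j) → cong (finToFun {k} {n ℕ.* 3} x)
        (cong (uncurry combine ∘ swap) (Fin.remQuot-combine {3} i j))))
    where
    transpose : Fin (3 ℕ.* n) ↔ Fin (n ℕ.* 3)
    transpose = ↔-sym Fin.*↔× ↔-∘ (×-comm (Fin 3) (Fin n) ↔-∘ Fin.*↔×)

  -- The recurrence in the number of columns and its solution.

  power : ℕ → ℤ
  power n = + (k ℕ.^ (n ℕ.* 3))

  power-suc : ∀ n → power (suc n) ≡ + k * (+ k * (+ k * power n))
  power-suc n = trans (ℤ.pos-* k _) (cong (+ k *_) (trans (ℤ.pos-* k _) (cong (+ k *_) (ℤ.pos-* k _))))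

  blocks-last : ∀ (x y z : Fin k) c → + blocks {k} {1} ((x ∷ y ∷ z ∷ []) ▹ c) ≡ classes (δ x y) (δ x z) (δ y z)
  blocks-last x y z c = trans (cong +_ (ℕ.+-identityʳ _))
    (trans (newBlocks-colors (x ∷ y ∷ z ∷ []) (link ((x ∷ y ∷ z ∷ []) ▹ c)))
      (unlinked (classes (δ x y) (δ x z) (δ y z)) (δ x y) (δ x z) (δ y z)))
    where
    unlinked : ∀ d e f g → d - (+ 0 + + 0 + + 0 - e * + 0 * + 0 - f * + 0 * + 0 - g * + 0 * + 0 +
                                 e * g * + 0 * + 0 * + 0) ≡ d
    unlinked = solve-∀

  blocks-step : ∀ {n} (x y z u v w : Fin k) (c : Coloring k (U n)) →
    + blocks ((x ∷ y ∷ z ∷ []) ▹ (u ∷ v ∷ w ∷ []) ▹ c) ≡ fresh x y z u v w + + blocks ((u ∷ v ∷ w ∷ []) ▹ c)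
  blocks-step x y z u v w c = trans (ℤ.pos-+ (newBlocks (equal d) (link d)) _)
    (cong (_+ + blocks b) (newBlocks-colors (x ∷ y ∷ z ∷ []) (link d)))
    where
    b = (u ∷ v ∷ w ∷ []) ▹ c
    d = (x ∷ y ∷ z ∷ []) ▹ b

  total-one : total 1 (λ c → + blocks c) ≡ + 3 * (+ k * + k * + k) - + 3 * (+ k * + k) + + k
  total-one = trans (total-suc 0 blocks-ext) (trans
    -- Without columns there is a single coloring, so the inner sum has one term.
    (∑³-cong λ x y z → trans (ℤ.+-identityʳ _) (blocks-last x y z (byColumns (finToFun {k} {0} zero))))
    ∑³-classes)

  -- Two columns are exposed to isolate the local term, which recurs for each of the `power n`
  -- colorings of the rest. The second column is then folded back; the remaining count ignores the
  -- first column, whence the factor `k` three times.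
  total-step : ∀ n → total (2 ℕ.+ n) (λ c → + blocks c) ≡
    power n * ∑³ (λ x y z → ∑³ (fresh x y z)) + + k * (+ k * (+ k * total (1 ℕ.+ n) (λ c → + blocks c)))
  total-step n = begin
    total (2 ℕ.+ n) (λ c → + blocks c)
      ≡⟨ total-suc (suc n) blocks-ext ⟩
    ∑³ (λ x y z → total (suc n) (λ c → + blocks ((x ∷ y ∷ z ∷ []) ▹ c)))
      ≡⟨ (∑³-cong λ x y z → trans
           (total-suc n (λ c≗d → blocks-ext (▹-congʳ (x ∷ y ∷ z ∷ []) c≗d)))
           (∑³-cong λ u v w → trans
             (total-cong n (blocks-step x y z u v w))
             (total-affine (fresh x y z u v w) (λ c → + blocks ((u ∷ v ∷ w ∷ []) ▹ c))))) ⟩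
    ∑³ (λ x y z → ∑³ (λ u v w → power n * fresh x y z u v w + rest u v w))
      ≡⟨ (∑³-cong λ x y z → trans
           (∑³-distrib-+ (λ u v w → power n * fresh x y z u v w) rest)
           (cong₂ _+_ (∑³-*ˡ (power n) (fresh x y z)) (sym (total-suc n blocks-ext)))) ⟩
    ∑³ (λ x y z → power n * ∑³ (fresh x y z) + total (1 ℕ.+ n) (λ c → + blocks c))
      ≡⟨ ∑³-distrib-+ (λ x y z → power n * ∑³ (fresh x y z)) (λ _ _ _ → total (1 ℕ.+ n) (λ c → + blocks c)) ⟩
    ∑³ (λ x y z → power n * ∑³ (fresh x y z)) + ∑³ (λ _ _ _ → total (1 ℕ.+ n) (λ c → + blocks c))
      ≡⟨ cong₂ _+_ (∑³-*ˡ (power n) (λ x y z → ∑³ (fresh x y z))) (∑³-const (total (1 ℕ.+ n) (λ c → + blocks c))) ⟩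
    power n * ∑³ (λ x y z → ∑³ (fresh x y z)) + + k * (+ k * (+ k * total (1 ℕ.+ n) (λ c → + blocks c))) ∎
    where
    open ≡-Reasoning
    rest : Fin k → Fin k → Fin k → ℤ
    rest u v w = total n (λ c → + blocks ((u ∷ v ∷ w ∷ []) ▹ c))
    total-affine : ∀ a F → total n (λ c → a + F c) ≡ power n * a + total n F
    total-affine a F = trans (∑-distrib-+ {k ℕ.^ (n ℕ.* 3)} (λ _ → a) (F ∘ byColumns ∘ finToFun))
      (cong (_+ total n F) (∑-const (k ℕ.^ (n ℕ.* 3)) a))

  -- The factor `k ^ 5` keeps the claim in the integers, since the exponent `3 * n - 5` is negative
  -- for one column. Induction starts there, as the recurrence needs a next column.
  total-closed : ∀ n → total (suc n) (λ c → + blocks c) * (+ k) ^ 5 ≡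
                 power (suc n) * (intercept (+ k) - slope (+ k) * + suc n)
  total-closed zero = trans (cong (_* (+ k) ^ 5) total-one)
    (trans (base (+ k)) (cong (_* (intercept (+ k) - slope (+ k) * + 1)) (sym (power-suc 0))))
    where
    -- Powers are spelled out in the form to which `_^_` unfolds, so the identity matches the goal
    -- by computation.
    base : ∀ κ → (+ 3 * (κ * κ * κ) - + 3 * (κ * κ) + κ) * (κ * (κ * (κ * (κ * (κ * + 1))))) ≡
      κ * (κ * (κ * + 1)) * ((+ 1 - + 3 * (κ * (κ * + 1)) + + 3 * (κ * (κ * (κ * (κ * + 1))))) -
        (+ 1 - κ) * ((+ 1 - κ) * ((+ 1 - κ) * + 1)) * (+ 1 + + 3 * κ + + 3 * (κ * (κ * + 1))) * + 1)
    base = solve-∀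
  total-closed (suc n) = begin
    total (2 ℕ.+ n) (λ c → + blocks c) * κ ^ 5
      ≡⟨ cong (_* κ ^ 5) (trans (total-step n) (cong (λ s → p * s + κ * (κ * (κ * t))) ∑³-fresh)) ⟩
    (p * _ + κ * (κ * (κ * t))) * κ ^ 5
      -- The local term summed over two columns equals `- κ * slope κ`. Factoring out three copies
      -- of `κ` exposes `t * κ ^ 5` for the induction hypothesis.
      ≡⟨ split κ p t ⟩
    κ * (κ * (κ * (t * κ ^ 5 - κ * (κ * (κ * p)) * slope κ)))
      ≡⟨ cong (λ s → κ * (κ * (κ * (s - κ * (κ * (κ * p)) * slope κ))))
           (trans (total-closed n) (cong (_* (intercept κ - slope κ * + suc n)) (power-suc n))) ⟩
    κ * (κ * (κ * (κ * (κ * (κ * p)) * (intercept κ - slope κ * + suc n) - κ * (κ * (κ * p)) * slope κ)))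
      ≡⟨ merge κ (κ * (κ * (κ * p))) (intercept κ) (slope κ) (+ suc n) ⟩
    κ * (κ * (κ * (κ * (κ * (κ * p))))) * (intercept κ - slope κ * (+ 1 + + suc n))
      ≡⟨ cong (_* (intercept κ - slope κ * + suc (suc n))) (sym (trans (power-suc (suc n))
           (cong (λ q → κ * (κ * (κ * q))) (power-suc n)))) ⟩
    power (2 ℕ.+ n) * (intercept κ - slope κ * + suc (suc n)) ∎
    where
    open ≡-Reasoning
    κ = + k
    p = power n
    t = total (suc n) (λ c → + blocks c)
    split : ∀ κ p t →
      (p * (κ * κ * κ * (+ 3 * (κ * κ * κ) - + 3 * (κ * κ) + κ) -
            (+ 3 * (κ * κ * κ * κ * κ) - + 3 * (κ * κ * κ) + κ)) + κ * (κ * (κ * t))) *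
        (κ * (κ * (κ * (κ * (κ * + 1))))) ≡
      κ * (κ * (κ * (t * (κ * (κ * (κ * (κ * (κ * + 1))))) - κ * (κ * (κ * p)) *
        ((+ 1 - κ) * ((+ 1 - κ) * ((+ 1 - κ) * + 1)) * (+ 1 + + 3 * κ + + 3 * (κ * (κ * + 1)))))))
    split = solve-∀
    merge : ∀ κ q a b m → κ * (κ * (κ * (q * (a - b * m) - q * b))) ≡ κ * (κ * (κ * q)) * (a - b * (+ 1 + m))
    merge = solve-∀

-- From the integer identity to the rational expectation.

sum-tabulate : ∀ {n} (f : Fin n → ℕ) → + ListAction.sum (tabulate f) ≡ ∑[ i < n ] (+ f i)
sum-tabulate {zero}  f = refl
sum-tabulate {suc n} f = trans (ℤ.pos-+ (f zero) _) (cong (_+_ (+ f zero)) (sum-tabulate (f ∘ suc)))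

/-homo-* : ∀ a b m n .{{_ : NonZero m}} .{{_ : NonZero n}} .{{_ : NonZero (m ℕ.* n)}} →
           (a / m) ℚ.* (b / n) ≡ (a * b) / (m ℕ.* n)
/-homo-* a b m@(suc m-1) n@(suc n-1) = ℚ.toℚᵘ-injective (begin
  ℚ.toℚᵘ ((a / m) ℚ.* (b / n))
    ≈⟨ ℚ.toℚᵘ-homo-* (a / m) (b / n) ⟩
  ℚ.toℚᵘ (a / m) ℚᵘ.* ℚ.toℚᵘ (b / n)
    ≈⟨ ℚᵘ.*-cong (ℚ.toℚᵘ-fromℚᵘ (mkℚᵘ a m-1)) (ℚ.toℚᵘ-fromℚᵘ (mkℚᵘ b n-1)) ⟩
  mkℚᵘ a m-1 ℚᵘ.* mkℚᵘ b n-1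
    ≈⟨ ℚ.toℚᵘ-fromℚᵘ (mkℚᵘ a m-1 ℚᵘ.* mkℚᵘ b n-1) ⟨
  ℚ.toℚᵘ ((a * b) / (m ℕ.* n)) ∎)
  where open ℚᵘ.≃-Reasoning

/-cancelʳ : ∀ z m .{{_ : NonZero m}} → (z * + m) / m ≡ z / 1
/-cancelʳ z m@(suc _) = ℚ.fromℚᵘ-cong {mkℚᵘ (z * + m) _} {mkℚᵘ z 0} (*≡* (ℤ.*-identityʳ (z * + m)))

/-*-cancel : ∀ z m .{{_ : NonZero m}} → (z / m) ℚ.* (+ m / 1) ≡ z / 1
/-*-cancel z m@(suc _) = trans (/-homo-* z (+ m) m 1)
  (trans (ℚ./-cong {z * + m} refl (ℕ.*-identityʳ m)) (/-cancelʳ z m))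

*-÷-cancel : ∀ p q .{{_ : ℚ.NonZero q}} → (p ℚ.* q) ÷ q ≡ p
*-÷-cancel p q = trans (ℚ.*-assoc p q (ℚ.1/ q)) (trans (cong (p ℚ.*_) (ℚ.*-inverseʳ q)) (ℚ.*-identityʳ p))

module _ (k : ℕ) .{{_ : NonZero k}} where

  ^ᶻ-suc : ∀ m → k ^ᶻ (+ suc m) ≡ k ^ᶻ (+ m) ℚ.* (+ k / 1)
  ^ᶻ-suc m = trans (ℚ./-cong (trans (cong +_ (ℕ.*-comm k (k ℕ.^ m))) (ℤ.pos-* (k ℕ.^ m) k)) refl)
    (sym (/-homo-* (+ (k ℕ.^ m)) (+ k) 1 1))

  -- Lowering both exponents together leaves `m ⊖ n` unchanged, which reduces to the cases where one
  -- of them is zero.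
  ^ᶻ-⊖ : ∀ m n → k ^ᶻ (m ⊖ n) ℚ.* k ^ᶻ (+ n) ≡ k ^ᶻ (+ m)
  ^ᶻ-⊖ m       zero    = ℚ.*-identityʳ (k ^ᶻ (+ m))
  ^ᶻ-⊖ zero    (suc n) = /-*-cancel (+ 1) (k ℕ.^ suc n) {{ℕ.m^n≢0 k (suc n)}}
  ^ᶻ-⊖ (suc m) (suc n) = begin
    k ^ᶻ (suc m ⊖ suc n) ℚ.* k ^ᶻ (+ suc n)        ≡⟨ cong₂ (λ z q → k ^ᶻ z ℚ.* q) (ℤ.[1+m]⊖[1+n]≡m⊖n m n) (^ᶻ-suc n) ⟩
    k ^ᶻ (m ⊖ n) ℚ.* (k ^ᶻ (+ n) ℚ.* (+ k / 1))    ≡⟨ ℚ.*-assoc (k ^ᶻ (m ⊖ n)) (k ^ᶻ (+ n)) (+ k / 1) ⟨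
    k ^ᶻ (m ⊖ n) ℚ.* k ^ᶻ (+ n) ℚ.* (+ k / 1)      ≡⟨ cong (ℚ._* (+ k / 1)) (^ᶻ-⊖ m n) ⟩
    k ^ᶻ (+ m) ℚ.* (+ k / 1)                       ≡⟨ ^ᶻ-suc m ⟨
    k ^ᶻ (+ suc m)                                 ∎
    where open ≡-Reasoning

  -- In the rationals the hypothesis becomes `t` times `k ^ n` equals `k ^ (m - n)` times `c` times
  -- `k ^ n`; the nonzero factor cancels, and division by `k ^ m` follows.
  /-^ᶻ : ∀ t c m n → t * + (k ℕ.^ n) ≡ + (k ℕ.^ m) * c →
    _/_ t (k ℕ.^ m) {{ℕ.m^n≢0 k m}} ≡
    _÷_ (k ^ᶻ (+ m - + n) ℚ.* (c / 1)) (k ^ᶻ (+ m)) {{^ᶻ-nonZero k (+ m)}}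
  /-^ᶻ t c m n eq = begin
    t/kᵐ                                   ≡⟨ *-÷-cancel t/kᵐ kᵐ ⟨
    (t/kᵐ ℚ.* kᵐ) ÷ kᵐ                     ≡⟨ cong (_÷ kᵐ) (/-*-cancel t (k ℕ.^ m)) ⟩
    (t / 1) ÷ kᵐ                           ≡⟨ cong (_÷ kᵐ) (*-÷-cancel (t / 1) kⁿ) ⟨
    (((t / 1) ℚ.* kⁿ) ÷ kⁿ) ÷ kᵐ           ≡⟨ cong (λ q → (q ÷ kⁿ) ÷ kᵐ) scaled ⟩
    ((k ^ᶻ (+ m - + n) ℚ.* (c / 1)) ℚ.* kⁿ ÷ kⁿ) ÷ kᵐ ≡⟨ cong (_÷ kᵐ) (*-÷-cancel (k ^ᶻ (+ m - + n) ℚ.* (c / 1)) kⁿ) ⟩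
    (k ^ᶻ (+ m - + n) ℚ.* (c / 1)) ÷ kᵐ ∎
    where
    open ≡-Reasoning
    instance
      kᵐ≢0 : NonZero (k ℕ.^ m)
      kᵐ≢0 = ℕ.m^n≢0 k m
    kᵐ kⁿ t/kᵐ : ℚ
    kᵐ = k ^ᶻ (+ m)
    kⁿ = k ^ᶻ (+ n)
    t/kᵐ = t / (k ℕ.^ m)
    instance
      kᵐ-nonZero : ℚ.NonZero kᵐ
      kᵐ-nonZero = ^ᶻ-nonZero k (+ m)
      kⁿ-nonZero : ℚ.NonZero kⁿ
      kⁿ-nonZero = ^ᶻ-nonZero k (+ n)
    scaled : (t / 1) ℚ.* kⁿ ≡ (k ^ᶻ (+ m - + n) ℚ.* (c / 1)) ℚ.* kⁿ
    scaled = begin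
      (t / 1) ℚ.* kⁿ                                ≡⟨ /-homo-* t (+ (k ℕ.^ n)) 1 1 ⟩
      (t * + (k ℕ.^ n)) / 1                         ≡⟨ ℚ./-cong eq refl ⟩
      (+ (k ℕ.^ m) * c) / 1                         ≡⟨ /-homo-* (+ (k ℕ.^ m)) c 1 1 ⟨
      kᵐ ℚ.* (c / 1)                                ≡⟨ cong (ℚ._* (c / 1)) (^ᶻ-⊖ m n) ⟨
      k ^ᶻ (m ⊖ n) ℚ.* kⁿ ℚ.* (c / 1)               ≡⟨ cong (λ z → k ^ᶻ z ℚ.* kⁿ ℚ.* (c / 1)) (ℤ.m-n≡m⊖n m n) ⟨
      k ^ᶻ (+ m - + n) ℚ.* kⁿ ℚ.* (c / 1)           ≡⟨ ℚ.*-assoc (k ^ᶻ (+ m - + n)) kⁿ (c / 1) ⟩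
      k ^ᶻ (+ m - + n) ℚ.* (kⁿ ℚ.* (c / 1))         ≡⟨ cong (k ^ᶻ (+ m - + n) ℚ.*_) (ℚ.*-comm kⁿ (c / 1)) ⟩
      k ^ᶻ (+ m - + n) ℚ.* ((c / 1) ℚ.* kⁿ)         ≡⟨ ℚ.*-assoc (k ^ᶻ (+ m - + n)) (c / 1) kⁿ ⟨
      (k ^ᶻ (+ m - + n) ℚ.* (c / 1)) ℚ.* kⁿ         ∎

pos-^ : ∀ k n → + (k ℕ.^ n) ≡ (+ k) ^ n
pos-^ k zero    = refl
pos-^ k (suc n) = trans (ℤ.pos-* k (k ℕ.^ n)) (cong (+ k *_) (pos-^ k n))

corollary6p2 : ∀ (k n : ℕ) .{{_ : NonZero k}} .{{_ : NonZero n}} →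
    𝔼[X] k (U n) ≡
    _÷_ (k ^ᶻ (+ (3 ℕ.* n) - + 5) ℚ.*
    (((+ 1 - + 3 * (+ k) ^ 2 + + 3 * (+ k) ^ 4)
    - (+ 1 - + k) ^ 3 * (+ 1 + + 3 * + k + + 3 * (+ k) ^ 2) * + n) / 1))
    (k ^ᶻ (+ (3 ℕ.* n)))
    {{^ᶻ-nonZero k (+ (3 ℕ.* n))}}
corollary6p2 k n@(suc n-1) = /-^ᶻ k (+ t) (intercept (+ k) - slope (+ k) * + n) (3 ℕ.* n) 5 (begin
  + t * + (k ℕ.^ 5)
    ≡⟨ cong₂ _*_ (trans (sum-tabulate X) (total-numBlocks {k} n)) (pos-^ k 5) ⟩
  total {k} n (λ c → + blocks c) * (+ k) ^ 5
    ≡⟨ total-closed {k} n-1 ⟩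
  power {k} n * (intercept (+ k) - slope (+ k) * + n)
    -- The exponent is `n * 3` when counting by columns and `3 * n` in the order of `U n`.
    ≡⟨ cong (λ m → + (k ℕ.^ m) * (intercept (+ k) - slope (+ k) * + n)) (ℕ.*-comm n 3) ⟩
  + (k ℕ.^ (3 ℕ.* n)) * (intercept (+ k) - slope (+ k) * + n) ∎)
  where
  open ≡-Reasoning
  X : Fin (k ℕ.^ (3 ℕ.* n)) → ℕ
  X i = numBlocks (U n) (coloring k (U n) i)
  t = ListAction.sum (tabulate X)
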